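{- For every bipartite graph $G$, there exists an integer $k \geq 1$ such that $G$ is $C_{2k+1}$-mixing.
   Context: Graphs are finite and simple. $C_n$ is the cycle on $n$ vertices. A graph $G$ is $H$-mixing if any two homomorphisms $G \to H$ are joined by a finite sequence of homomorphisms $G\to H$ in which consecutive homomorphisms differ on at most one vertex of $G$. -}

module Defs where

open import Data.Bool using (Bool)
open import Data.Fin using (Fin; toℕ)
open import Data.Fin.Properties using (toℕ<n)
open import Data.Nat using (ℕ; suc; _+_; _*_; _≤_; _%_; _≟_; NonZero; >-nonZero; s≤s; z≤n)
open import Data.Nat.DivMod using (m<n⇒m%n≡m; n%n≡0)
open import Data.Nat.Properties using (≤-trans; +-monoˡ-≤; *-monoʳ-≤; m≤n⇒m<n∨m≡n; 1+n≢n; <-irrefl)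
open import Data.Product using (Σ-syntax)
open import Data.Sum using (_⊎_; inj₁; inj₂; swap)
open import Level using (0ℓ)
open import Relation.Binary using (Rel; Decidable; Symmetric; Irreflexive)
open import Relation.Binary.Construct.Closure.ReflexiveTransitive using (Star)
open import Relation.Binary.PropositionalEquality using (_≡_; _≢_; refl; sym; trans; cong)
open import Relation.Nullary using (¬_)
open import Relation.Nullary.Decidable using (_⊎-dec_)

record Graph : Set₁ where
  field
    order     : ℕ
  Vertex : Set
  Vertex = Fin order
  field
    Adj       : Rel Vertex 0ℓ
    adj?      : Decidable Adj
    symmetric : Symmetric Adj
    loopless  : Irreflexive _≡_ Adj

open Graph public

Bipartite : Graph → Set
Bipartite G = Σ[ side ∈ (Vertex G → Bool) ] (∀ u v → Adj G u v → side u ≢ side v)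

record Hom (G H : Graph) : Set where
  field
    map       : Vertex G → Vertex H
    preserves : ∀ {u v} → Adj G u v → Adj H (map u) (map v)

open Hom public

DifferAtMostOnce : ∀ {G H} → Rel (Hom G H) 0ℓ
DifferAtMostOnce f g =
  ∀ u v → map f u ≢ map g u → map f v ≢ map g v → u ≡ v

-- `Mixing H G` says that G is H-mixing.  Pointwise equal homomorphisms are
-- related by DifferAtMostOnce, so although Star compares endpoints
-- intensionally, no function extensionality is needed to reach them.
Mixing : Graph → Graph → Set
Mixing H G = (f g : Hom G H) → Star DifferAtMostOnce f g

Next : (n : ℕ) .{{_ : NonZero n}} → Rel (Fin n) 0ℓ
Next n i j = toℕ j ≡ suc (toℕ i) % n

-- For n = 1 this adjacency would be a loop and for n = 2 a single edge, neither
-- of which is a cycle in a simple graph; hence the bound on n.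
C : (n : ℕ) → 3 ≤ n → Graph
C n 3≤n = record
  { order     = n
  ; Adj       = λ i j → Next n i j ⊎ Next n j i
  ; adj?      = λ i j → (toℕ j ≟ suc (toℕ i) % n) ⊎-dec (toℕ i ≟ suc (toℕ j) % n)
  ; symmetric = swap
  ; loopless  = λ where
      refl (inj₁ p) → next-irrefl _ p
      refl (inj₂ p) → next-irrefl _ p
  }
  where
  instance
    n≢0 : NonZero n
    n≢0 = >-nonZero (≤-trans (s≤s z≤n) 3≤n)

  next-irrefl : ∀ i → ¬ Next n i i
  next-irrefl i p with m≤n⇒m<n∨m≡n (toℕ<n i)
  ... | inj₁ 1+i<n = 1+n≢n (sym (trans p (m<n⇒m%n≡m 1+i<n)))
  ... | inj₂ 1+i≡n = <-irrefl 1≡n (≤-trans (s≤s (s≤s z≤n)) 3≤n)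
    where
    i≡0 : toℕ i ≡ 0
    i≡0 = trans p (trans (cong (_% n) 1+i≡n) (n%n≡0 n))
    1≡n : 1 ≡ n
    1≡n = trans (cong suc (sym i≡0)) 1+i≡n

3≤2k+1 : ∀ {k} → 1 ≤ k → 3 ≤ 2 * k + 1
3≤2k+1 1≤k = +-monoˡ-≤ 1 (*-monoʳ-≤ 2 1≤k)

{-# OPTIONS --safe #-}
-- Let n be the order of G.  A homomorphism f from G to an odd cycle with
-- m > n vertices misses some vertex c, so it maps into the path obtained by
-- deleting c and lifts to integer heights that differ by exactly 1 along edges.
-- As m is odd, adding m to the heights of the vertices whose parity disagrees
-- with the bipartition makes parity and side agree everywhere without changing
-- f or breaking an edge.  Folding the top level down by 2, one vertex at a time,
-- then brings the heights into {0 , 1}, where the bipartition determines them: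
-- every f is connected to the same homomorphism.
module Submission where

open import Defs
open import Data.Nat using (ℕ; _≤_; _+_; _*_)
open import Data.Product using (Σ; ∃-syntax)

open import Data.Bool using (Bool; true; false; not; if_then_else_)
import Data.Bool as Bool
open import Data.Bool.Properties using (¬-not; not-involutive; T-≡)
open import Data.Fin using (Fin; toℕ)
import Data.Fin as Fin
open import Data.Fin.Properties
  using (toℕ<n; toℕ-injective; toℕ-fromℕ<; any?; all?; ¬∀⟶∃¬; <⇒notInjective)
open import Data.Nat
  using (zero; suc; _<_; _<?_; _≟_; _<ᵇ_; _%_; NonZero; >-nonZero; s≤s; z≤n; s≤s⁻¹)
open import Data.Nat.DivMod
  using (_mod_; m%n<n; m<n⇒m%n≡m; n%n≡0; %-distribˡ-+; [m+n]%n≡m%n)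
open import Data.Nat.Properties
  using (≤-refl; ≤-trans; <⇒≤; <⇒<ᵇ; ≤∧≢⇒<; m≤m+n; m≤n+m; m≤n⇒m≤1+n; m≤n*m;
         m≤n⇒m<n∨m≡n;
         +-comm; +-suc; +-monoˡ-≤; n≢0⇒n>0; 1+n≰n; suc-injective)
open import Data.Product using (_,_; proj₁; proj₂)
open import Data.Sum using (_⊎_; inj₁; inj₂)
import Data.Sum as Sum
open import Function using (_∘_; Equivalence)
open import Relation.Binary.Construct.Closure.ReflexiveTransitive
  using (Star; ε; _◅_; _◅◅_; reverse)
open import Relation.Binary.PropositionalEquality
  using (_≡_; _≢_; _≗_; refl; sym; trans; cong; module ≡-Reasoning)
open import Relation.Nullary using (yes; no; contradiction)
open import Relation.Nullary.Decidable using (decidable-stable)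

-- Counting preliminaries.

<ᵇ-suc : ∀ {x j} → x ≢ j → (x <ᵇ j) ≡ (x <ᵇ suc j)
<ᵇ-suc {zero}  {zero}  x≢j = contradiction refl x≢j
<ᵇ-suc {zero}  {suc j} x≢j = refl
<ᵇ-suc {suc x} {zero}  x≢j = refl
<ᵇ-suc {suc x} {suc j} x≢j = <ᵇ-suc {x} {j} (x≢j ∘ cong suc)

-- If every value were hit, choosing preimages would inject `Fin m` into the smaller `Fin n`.
missed-vertex : ∀ {n m} → n < m → (f : Fin n → Fin m) → ∃[ c ] (∀ u → f u ≢ c)
missed-vertex {m = m} n<m f with all? (λ c → any? (λ u → f u Fin.≟ c))
... | yes onto = contradiction (λ {c} {d} → section-injective {c} {d}) (<⇒notInjective n<m)
  where
  section-injective : ∀ {c d} → proj₁ (onto c) ≡ proj₁ (onto d) → c ≡ d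
  section-injective {c} {d} eq =
    trans (sym (proj₂ (onto c))) (trans (cong f eq) (proj₂ (onto d)))
... | no ¬onto
  with c , c∉f ← ¬∀⟶∃¬ m _ (λ c → any? (λ u → f u Fin.≟ c)) ¬onto
  = c , λ u fu≡c → c∉f (u , fu≡c)

-- Moving between homomorphisms one vertex at a time.

module _ {G K : Graph} where

  ≗⇒DifferAtMostOnce : (f g : Hom G K) → map f ≗ map g → DifferAtMostOnce f g
  ≗⇒DifferAtMostOnce _ _ f≗g u _ fu≢gu _ = contradiction (f≗g u) fu≢gu

  DifferAtMostOnce-sym : (f g : Hom G K) → DifferAtMostOnce f g → DifferAtMostOnce g f
  DifferAtMostOnce-sym _ _ d u v gu≢fu gv≢fv = d u v (gu≢fu ∘ sym) (gv≢fv ∘ sym)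

  -- By symmetry of K, cross makes every vertexwise mixture of f and g a homomorphism.
  module _ (f g : Hom G K)
           (cross : ∀ {u v} → Adj G u v → Adj K (map f u) (map g v)) where

    hybrid : (Vertex G → Bool) → Hom G K
    hybrid s = record
      { map       = λ u → if s u then map g u else map f u
      ; preserves = λ {u} {v} → preserved u v
      }
      where
      preserved : ∀ u v → Adj G u v →
                  Adj K (if s u then map g u else map f u) (if s v then map g v else map f v)
      preserved u v uv with s u | s v
      ... | true  | true  = preserves g uv
      ... | true  | false = symmetric K (cross (symmetric G uv))
      ... | false | true  = cross uv
      ... | false | false = preserves f uv

    switch-below : ℕ → Hom G K
    switch-below j = hybrid (λ u → toℕ u <ᵇ j)

    -- The tests `_<ᵇ j` and `_<ᵇ suc j` disagree only at index `j`, so no other vertex can move.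
    switch-one : ∀ j → DifferAtMostOnce (switch-below j) (switch-below (suc j))
    switch-one j u v u-moves v-moves =
      toℕ-injective (trans (only-j u u-moves) (sym (only-j v v-moves)))
      where
      only-j : ∀ w → map (switch-below j) w ≢ map (switch-below (suc j)) w → toℕ w ≡ j
      only-j w moves = decidable-stable (toℕ w ≟ j)
        (λ w≢j → moves (cong (λ b → if b then map g w else map f w) (<ᵇ-suc w≢j)))

    switch-up-to : ∀ j → Star DifferAtMostOnce f (switch-below j)
    -- The maps agree by computation but the `preserves` proofs need not, so a step that moves no
    -- vertex bridges the two.
    switch-up-to zero    = ≗⇒DifferAtMostOnce f (switch-below 0) (λ _ → refl) ◅ ε
    switch-up-to (suc j) = switch-up-to j ◅◅ switch-one j ◅ ε

    cross⇒connected : Star DifferAtMostOnce f g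
    cross⇒connected = switch-up-to (order G) ◅◅
      ≗⇒DifferAtMostOnce (switch-below (order G)) g all-switched ◅ ε
      where
      all-switched : map (switch-below (order G)) ≗ map g
      all-switched u = cong (λ b → if b then map g u else map f u)
        (Equivalence.to T-≡ (<⇒<ᵇ (toℕ<n u)))

-- Parity and folding of heights.

Consecutive : ℕ → ℕ → Set
Consecutive x y = y ≡ suc x ⊎ x ≡ suc y

odd : ℕ → Bool
odd zero    = false
odd (suc n) = not (odd n)

odd-+-odd : ∀ x {m} → odd m ≡ true → odd (x + m) ≡ not (odd x)
odd-+-odd zero    odd-m = odd-m
odd-+-odd (suc x) odd-m = cong not (odd-+-odd x odd-m)

-- The summand `j` lets the lemma apply to `2 * k`, which unfolds to `k + (k + 0)`.
odd-+-self : ∀ k j → odd (k + (k + j)) ≡ odd j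
odd-+-self zero    j = refl
odd-+-self (suc k) j = begin
  not (odd (k + suc (k + j)))   ≡⟨ cong (not ∘ odd) (+-suc k (k + j)) ⟩
  not (not (odd (k + (k + j)))) ≡⟨ not-involutive _ ⟩
  odd (k + (k + j))             ≡⟨ odd-+-self k j ⟩
  odd j                         ∎
  where open ≡-Reasoning

odd-2k+1 : ∀ k → odd (2 * k + 1) ≡ true
odd-2k+1 k = begin
  odd (k + (k + 0) + 1)   ≡⟨ cong odd (+-comm (k + (k + 0)) 1) ⟩
  not (odd (k + (k + 0))) ≡⟨ cong not (odd-+-self k 0) ⟩
  true                    ∎
  where open ≡-Reasoning

bit : Bool → ℕ
bit b = if b then 1 else 0

bit-odd : ∀ {x} → x ≤ 1 → x ≡ bit (odd x)
bit-odd z≤n       = refl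
bit-odd (s≤s z≤n) = refl

bit-consecutive : ∀ {s t} → s ≢ t → Consecutive (bit s) (bit t)
bit-consecutive {false} {false} s≢t = contradiction refl s≢t
bit-consecutive {false} {true}  _   = inj₁ refl
bit-consecutive {true}  {false} _   = inj₂ refl
bit-consecutive {true}  {true}  s≢t = contradiction refl s≢t

fold : ℕ → ℕ → ℕ
fold N x with x ≟ suc (suc N)
... | yes _ = N
... | no  _ = x

fold-≤ : ∀ {N x} → x ≤ suc (suc N) → fold N x ≤ suc N
fold-≤ {N} {x} x≤2+N with x ≟ suc (suc N)
... | yes _    = m≤n+m N 1
... | no x≢2+N = s≤s⁻¹ (≤∧≢⇒< x≤2+N x≢2+N)

odd-fold : ∀ N x → odd (fold N x) ≡ odd x
odd-fold N x with x ≟ suc (suc N)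
... | yes refl = sym (not-involutive _)
... | no _     = refl

-- If `y` is the top level, the bound on `x` forces `x` to be `suc N`, which is next to both
-- `suc (suc N)` and `N`. This supplies the `cross` condition between a height function and its
-- folding.
fold-consecutiveʳ : ∀ {N x y} → x ≤ suc (suc N) → Consecutive x y → Consecutive x (fold N y)
fold-consecutiveʳ {N} {x} {y} x≤2+N xy with y ≟ suc (suc N)
... | no _     = xy
fold-consecutiveʳ x≤2+N (inj₁ y≡1+x) | yes refl = inj₂ (sym (suc-injective y≡1+x))
fold-consecutiveʳ x≤2+N (inj₂ refl)  | yes refl = contradiction x≤2+N 1+n≰n

fold-consecutive : ∀ {N x y} → x ≤ suc (suc N) → y ≤ suc (suc N) →
                   Consecutive x y → Consecutive (fold N x) (fold N y)
fold-consecutive {N} {x} x≤2+N y≤2+N xy with x ≟ suc (suc N)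
fold-consecutive         x≤2+N y≤2+N xy          | no _     = fold-consecutiveʳ x≤2+N xy
fold-consecutive         x≤2+N y≤2+N (inj₁ refl) | yes refl = contradiction y≤2+N 1+n≰n
-- Here `y` is `suc N`; the test on it makes `fold N y` reduce to `suc N`.
fold-consecutive {N}     x≤2+N y≤2+N (inj₂ refl) | yes refl with suc N ≟ suc (suc N)
... | no _    = inj₁ refl
... | yes ()

-- Lifting residues modulo `m` to heights.

-- The representative of x modulo m in the window c ≤ _ < c + m, for x , c < m.
unroll : ℕ → ℕ → ℕ → ℕ
unroll m c x with x <? c
... | yes _ = x + m
... | no  _ = x

align : ℕ → Bool → ℕ → ℕ
align m s x with odd x Bool.≟ s
... | yes _ = x
... | no  _ = x + m

odd-align : ∀ {m} → odd m ≡ true → ∀ s x → odd (align m s x) ≡ s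
odd-align odd-m s x with odd x Bool.≟ s
... | yes odd≡s = odd≡s
... | no  odd≢s = trans (odd-+-odd x odd-m) (sym (¬-not (odd≢s ∘ sym)))

-- A successor flips the parity and `s ≢ t` flips the target, so either both heights are shifted by
-- `m` or neither is.
align-suc : ∀ {m s t} x → s ≢ t → align m t (suc x) ≡ suc (align m s x)
align-suc {s = s} {t} x s≢t with odd x Bool.≟ s | not (odd x) Bool.≟ t
... | yes _    | yes _     = refl
... | no  _    | no  _     = refl
... | yes refl | no  not≢t = contradiction (sym (¬-not (s≢t ∘ sym))) not≢t
... | no odd≢s | yes refl  = contradiction (¬-not (odd≢s ∘ sym)) s≢t

align-consecutive : ∀ {m s t x y} → s ≢ t →
                    Consecutive x y → Consecutive (align m s x) (align m t y)
align-consecutive {x = x} s≢t (inj₁ refl) = inj₁ (align-suc x s≢t)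
align-consecutive {y = y} s≢t (inj₂ refl) = inj₂ (align-suc y (s≢t ∘ sym))

module _ {m : ℕ} .{{_ : NonZero m}} where

  unroll-% : ∀ c x → unroll m c x % m ≡ x % m
  unroll-% c x with x <? c
  ... | yes _ = [m+n]%n≡m%n x m
  ... | no  _ = refl

  align-% : ∀ s x → align m s x % m ≡ x % m
  align-% s x with odd x Bool.≟ s
  ... | yes _ = refl
  ... | no  _ = [m+n]%n≡m%n x m

  unroll-≤ : ∀ c x → unroll m c x ≤ x + m
  unroll-≤ c x with x <? c
  ... | yes _ = ≤-refl
  ... | no  _ = m≤m+n x m

  align-≤ : ∀ s x → align m s x ≤ x + m
  align-≤ s x with odd x Bool.≟ s
  ... | yes _ = m≤m+n x m
  ... | no  _ = ≤-refl

  suc-% : 1 < m → ∀ x → suc x % m ≡ suc (x % m) % m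
  suc-% 1<m x = begin
    suc x % m               ≡⟨ %-distribˡ-+ 1 x m ⟩
    (1 % m + x % m) % m     ≡⟨ cong (λ o → (o + x % m) % m) (m<n⇒m%n≡m 1<m) ⟩
    suc (x % m) % m         ∎
    where open ≡-Reasoning

  -- The window is cut just before `c`, so the only edge of the cycle that it breaks is the one
  -- entering `c`, which `y ≢ c` excludes.
  unroll-next : ∀ {c x y} → c < m → x < m → y ≢ c →
                y ≡ suc x % m → unroll m c y ≡ suc (unroll m c x)
  unroll-next {c} {x} {y} c<m x<m y≢c y≡ with m≤n⇒m<n∨m≡n x<m
  ... | inj₁ 1+x<m with refl ← trans y≡ (m<n⇒m%n≡m 1+x<m) | x <? c | suc x <? c
  ...   | yes _   | yes _     = refl
  ...   | no  _   | no  _     = refl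
  ...   | yes x<c | no  1+x≮c = contradiction (≤∧≢⇒< x<c y≢c) 1+x≮c
  ...   | no  x≮c | yes 1+x<c = contradiction (<⇒≤ 1+x<c) x≮c
  -- At the wraparound `x` is the last residue and `y` is 0. Since `c` is not 0, the window raises 0
  -- to `m`, the successor of `x`.
  unroll-next {c} {x} c<m x<m y≢c y≡ | inj₂ refl
    with refl ← trans y≡ (n%n≡0 (suc x)) | x <? c | 0 <? c
  ...   | yes x<c | _       = contradiction (≤-trans c<m x<c) 1+n≰n
  ...   | no  _   | yes _   = refl
  ...   | no  _   | no  0≮c = contradiction (n≢0⇒n>0 (y≢c ∘ sym)) 0≮c

-- Height functions and the homomorphisms they induce.

module _ (G : Graph) where

  record Height : Set where
    field
      height      : Vertex G → ℕ
      consecutive : ∀ {u v} → Adj G u v → Consecutive (height u) (height v)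

  open Height

  folded : ∀ N (h : Height) → (∀ u → height h u ≤ suc (suc N)) → Height
  folded N h h≤2+N = record
    { height      = fold N ∘ height h
    ; consecutive = λ {u} {v} uv → fold-consecutive (h≤2+N u) (h≤2+N v) (consecutive h uv)
    }

  module _ {m : ℕ} (3≤m : 3 ≤ m) where

    private instance
      m≢0 : NonZero m
      m≢0 = >-nonZero (≤-trans (s≤s z≤n) 3≤m)

    consecutive⇒adj : ∀ {x y} → Consecutive x y → Adj (C m 3≤m) (x mod m) (y mod m)
    consecutive⇒adj = Sum.map next next
      where
      next : ∀ {x y} → y ≡ suc x → Next m (x mod m) (y mod m)
      next {x} refl = begin
        toℕ (suc x mod m)         ≡⟨ toℕ-fromℕ< (m%n<n (suc x) m) ⟩
        suc x % m                 ≡⟨ suc-% (≤-trans (s≤s (s≤s z≤n)) 3≤m) x ⟩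
        suc (x % m) % m           ≡⟨ cong (λ r → suc r % m) (toℕ-fromℕ< (m%n<n x m)) ⟨
        suc (toℕ (x mod m)) % m   ∎
        where open ≡-Reasoning

    wrap : Height → Hom G (C m 3≤m)
    wrap h = record
      { map       = λ u → height h u mod m
      ; preserves = λ uv → consecutive⇒adj (consecutive h uv)
      }

    module _ (side : Vertex G → Bool) (proper : ∀ u v → Adj G u v → side u ≢ side v) where

      two-level : Height
      two-level = record
        { height      = bit ∘ side
        ; consecutive = λ {u} {v} uv → bit-consecutive (proper u v uv)
        }

      wrap-connected : ∀ N (h : Height) → (∀ u → height h u ≤ suc N) →
                       (∀ u → odd (height h u) ≡ side u) →
                       Star DifferAtMostOnce (wrap h) (wrap two-level)
      wrap-connected zero h h≤1 odd-h = ≗⇒DifferAtMostOnce (wrap h) (wrap two-level) (λ u →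
        cong (_mod m) (trans (bit-odd (h≤1 u)) (cong bit (odd-h u)))) ◅ ε
      wrap-connected (suc N) h h≤2+N odd-h =
        -- Top-level vertices are pairwise non-adjacent, so they can be lowered in any order; the
        -- bound drops by one and parities stay.
        cross⇒connected (wrap h) (wrap (folded N h h≤2+N))
          (λ {u} {v} uv → consecutive⇒adj (fold-consecutiveʳ (h≤2+N u) (consecutive h uv)))
        ◅◅ wrap-connected N (folded N h h≤2+N) (λ u → fold-≤ (h≤2+N u))
             (λ u → trans (odd-fold N (height h u)) (odd-h u))

      module _ (odd-m : odd m ≡ true) (n<m : order G < m) where

        connected : (f : Hom G (C m 3≤m)) → Star DifferAtMostOnce f (wrap two-level)
        connected f with missed-vertex n<m (map f)
        ... | c , c∉f = ≗⇒DifferAtMostOnce f (wrap lift) f≗wrap ◅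
                        wrap-connected _ lift (λ u → m≤n⇒m≤1+n (lift-≤ u))
                          (λ u → odd-align odd-m (side u) (unrolled u))
          where
          unrolled : Vertex G → ℕ
          unrolled u = unroll m (toℕ c) (toℕ (map f u))

          next⇒suc : ∀ u v → Next m (map f u) (map f v) → unrolled v ≡ suc (unrolled u)
          next⇒suc u v = unroll-next (toℕ<n c) (toℕ<n (map f u)) (c∉f v ∘ toℕ-injective)

          lift : Height
          lift = record
            { height      = λ u → align m (side u) (unrolled u)
            ; consecutive = λ {u} {v} uv → align-consecutive (proper u v uv)
                (Sum.map (next⇒suc u v) (next⇒suc v u) (preserves f uv))
            }

          -- A crude bound suffices, as it only fixes the number of folds: one `m` for the residue,
          -- one for `unroll`, one for `align`.
          lift-≤ : ∀ u → height lift u ≤ m + m + m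
          lift-≤ u = ≤-trans (align-≤ (side u) (unrolled u))
            (+-monoˡ-≤ m (≤-trans (unroll-≤ (toℕ c) (toℕ (map f u)))
              (+-monoˡ-≤ m (<⇒≤ (toℕ<n (map f u))))))

          f≗wrap : ∀ u → map f u ≡ height lift u mod m
          f≗wrap u = toℕ-injective (begin
            toℕ (map f u)              ≡⟨ m<n⇒m%n≡m (toℕ<n (map f u)) ⟨
            toℕ (map f u) % m          ≡⟨ unroll-% (toℕ c) (toℕ (map f u)) ⟨
            unrolled u % m             ≡⟨ align-% (side u) (unrolled u) ⟨
            height lift u % m          ≡⟨ toℕ-fromℕ< (m%n<n (height lift u) m) ⟨
            toℕ (height lift u mod m)  ∎)
            where open ≡-Reasoning

        mixing : Mixing (C m 3≤m) G
        mixing f g = connected f ◅◅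
          reverse (λ {h} {h′} → DifferAtMostOnce-sym h h′) (connected g)

theorem2p7 : (G : Graph) → Bipartite G → ∃[ k ] Σ (1 ≤ k) (λ 1≤k → Mixing (C (2 * k + 1) (3≤2k+1 1≤k)) G)
theorem2p7 G (side , proper) =
  k , s≤s z≤n , mixing G (3≤2k+1 {k} (s≤s z≤n)) side proper (odd-2k+1 k) n<2k+1
  where
  k : ℕ
  -- The successor keeps `k` positive even for the empty graph and already exceeds the order of `G`.
  k = suc (order G)

  n<2k+1 : order G < 2 * k + 1
  n<2k+1 = ≤-trans (m≤n*m k 2) (m≤m+n (2 * k) 1)
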